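{- Let $N$ and $N'$ be image-finite labeled fluid stochastic Petri nets (LFSPNs), each having exactly one continuous place. Then $$N\equiv_{fl}N'\ \Leftrightarrow\ N=_{HML_{flt}}N',$$ i.e. $N$ and $N'$ are fluid trace equivalent if and only if they are logically equivalent in the fluid modal logic $HML_{flt}$.
   Context: Notation: $\mathbb N=\{0,1,2,\ldots\}$; $Act$ is a set of actions; $X^*$ is the set of all finite sequences over a set $X$ (including the empty sequence $\varepsilon$); for sequences of numbers, $\circ$ denotes concatenation, and a number is identified with the sequence of length one. An LFSPN is a tuple $N=(P_N,T_N,W_N,C_N,R_N,\Omega_N,L_N,\mathcal M_N)$, where: $P_N=Pd_N\uplus Pc_N$ is a finite set of discrete places ($Pd_N$) and continuous places ($Pc_N$); $T_N$ is a finite set of transitions, $P_N\cup T_N\neq\emptyset$, $P_N\cap T_N=\emptyset$; $W_N:(Pd_N\times T_N)\cup(T_N\times Pd_N)\to\mathbb N$ gives weights of discrete arcs; $C_N\subseteq(Pc_N\times T_N)\cup(T_N\times Pc_N)$ is the set of continuous arcs; $R_N:C_N\times\mathbb N^{|Pd_N|}\to\mathbb R_{\ge0}$ gives flow rates of continuous arcs in a discrete marking; $\Omega_N:T_N\times\mathbb N^{|Pd_N|}\to\mathbb R_{>0}$ gives transition rates in a discrete marking; $L_N:T_N\to Act$ is the labeling; $\mathcal M_N=(M_N,\mathbf 0)$ is the initial marking, with $M_N\in\mathbb N^{|Pd_N|}$ the initial discrete marking and $\mathbf 0$ meaning all continuous places are empty. A discrete marking is $M:Pd_N\to\mathbb N$.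 $Ena(M)=\{t\in T_N\mid \forall p\in Pd_N\ W_N(p,t)\le M(p)\}$. For $t\in Ena(M)$ we write $M\stackrel{t}{\rightarrow}\widetilde M$, where $\widetilde M(p)=M(p)-W_N(p,t)+W_N(t,p)$ for all $p\in Pd_N$. $DRS(N)$ is the smallest set of discrete markings containing $M_N$ and closed under $\stackrel{t}{\rightarrow}$ for all $t$. For $a\in Act$, $Image(M,a)=\{\widetilde M\mid M\stackrel{t}{\rightarrow}\widetilde M,\ L_N(t)=a\}$; $N$ is image-finite if $|Image(M,a)|<\infty$ for all $M\in DRS(N)$, $a\in Act$. Let $Pc_N=\{q\}$. For $M\in DRS(N)$: $SJ(M)=1/\sum_{t\in Ena(M)}\Omega_N(t,M)$ is the average sojourn time (with $SJ(M)=\infty$ if $Ena(M)=\emptyset$); $PT(t,M)=\Omega_N(t,M)/\sum_{u\in Ena(M)}\Omega_N(u,M)$ for $t\in Ena(M)$; and the potential fluid flow rate is $$RP(M)=\sum_{\{t\in Ena(M)\mid (t,q)\in C_N\}}R_N((t,q),M)-\sum_{\{t\in Ena(M)\mid (q,t)\in C_N\}}R_N((q,t),M).$$ Fluid trace equivalence. $TranSeq(N)$ is the set of all transition sequences $\vartheta=t_1\cdots t_n$ ($n\ge0$; $\vartheta=\varepsilon$ for $n=0$) with $M_N=M_0\stackrel{t_1}{\rightarrow}M_1\cdots\stackrel{t_n}{\rightarrow}M_n$. For such $\vartheta$: $PT(\vartheta)=\prod_{i=1}^nPT(t_i,M_{i-1})$ (so $PT(\varepsilon)=1$), $L_N(\vartheta)=L_N(t_1)\cdots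 L_N(t_n)$, $SJ(\vartheta)=SJ(M_0)\circ\cdots\circ SJ(M_n)$, $RP(\vartheta)=RP(M_0)\circ\cdots\circ RP(M_n)$. For $(\sigma,\varsigma,\varrho)\in Act^*\times\mathbb R_{>0}^*\times\mathbb R^*$, $TranSeq(N,\sigma,\varsigma,\varrho)=\{\vartheta\in TranSeq(N)\mid L_N(\vartheta)=\sigma,\ SJ(\vartheta)=\varsigma,\ RP(\vartheta)=\varrho\}$. $N\equiv_{fl}N'$ iff for all $(\sigma,\varsigma,\varrho)\in Act^*\times\mathbb R_{>0}^*\times\mathbb R^*$: $\sum_{\vartheta\in TranSeq(N,\sigma,\varsigma,\varrho)}PT(\vartheta)=\sum_{\vartheta'\in TranSeq(N',\sigma,\varsigma,\varrho)}PT(\vartheta')$. Logic $HML_{flt}$. Formulas: $\Phi::=\top\mid\langle a\rangle\Phi$ with $a\in Act$; $\mathbf{HML}_{flt}$ is the set of all formulas. For $M\in DRS(N)$, $\varsigma\in\mathbb R_{>0}^*$, $\varrho\in\mathbb R^*$, the real value $[\![\Phi]\!]_{flt}(M,\varsigma,\varrho)$ is defined by: (1) $[\![\top]\!]_{flt}(M,\varsigma,\varrho)=1$ if $\varsigma=SJ(M)$ and $\varrho=RP(M)$, and $0$ otherwise; (2) $[\![\langle a\rangle\Phi]\!]_{flt}(M,\varsigma,\varrho)=0$ if $\varsigma=\varepsilon$, or $\varrho=\varepsilon$, or $\varsigma=s\circ\hat\varsigma$ with $SJ(M)\ne s$, or $\varrho=r\circ\hat\varrho$ with $RP(M)\ne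 r$; and if $\varsigma=s\circ\hat\varsigma$, $SJ(M)=s$, $\varrho=r\circ\hat\varrho$, $RP(M)=r$, then $$[\![\langle a\rangle\Phi]\!]_{flt}(M,\varsigma,\varrho)=\sum_{\{t\mid M\stackrel{t}{\rightarrow}\widetilde M,\ L_N(t)=a\}}PT(t,M)\,[\![\Phi]\!]_{flt}(\widetilde M,\hat\varsigma,\hat\varrho).$$ Set $[\![\Phi]\!]_{flt}(N,\varsigma,\varrho)=[\![\Phi]\!]_{flt}(M_N,\varsigma,\varrho)$. $N=_{HML_{flt}}N'$ iff $[\![\Phi]\!]_{flt}(N,\varsigma,\varrho)=[\![\Phi]\!]_{flt}(N',\varsigma,\varrho)$ for all $\Phi\in\mathbf{HML}_{flt}$, $\varsigma\in\mathbb R_{>0}^*$, $\varrho\in\mathbb R^*$. -}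

module Defs where

open import Algebra.Bundles using (CommutativeRing)
open import Axiom.ExcludedMiddle using (ExcludedMiddle)
open import Data.Bool.Base using (Bool; if_then_else_; T)
open import Data.Bool.Properties using (T?)
open import Data.Empty using (⊥; ⊥-elim)
open import Data.Fin.Base using (Fin)
open import Data.Fin.Properties using (any?; all?)
open import Data.List.Base
  using (List; []; _∷_; map; foldr; filter; length; allFin; cartesianProductWith)
import Data.List.Properties as Listₚ
open import Data.List.Membership.Propositional using () renaming (_∈_ to _∈ₗ_)
import Data.List.Membership.Propositional.Properties as ∈ₗ
open import Data.List.Relation.Binary.Pointwise using (Pointwise)
open import Data.List.Relation.Unary.All using ([])
open import Data.List.Relation.Unary.AllPairs using ([]; _∷_)
open import Data.List.Relation.Unary.Any using (here)
open import Data.List.Relation.Unary.Unique.Propositional using (Unique)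
import Data.List.Relation.Unary.Unique.Propositional.Properties as Unique
open import Data.Maybe.Base using (Maybe; just; nothing)
open import Data.Nat.Base as ℕ using (ℕ; zero; suc; _⊔_)
import Data.Nat.Properties as ℕ
open import Data.Product.Base using (Σ; ∃; _×_; _,_; proj₁; proj₂)
open import Data.Rational.Base as ℚ using (ℚ; 0ℚ; 1ℚ; ½; ∣_∣)
import Data.Rational.Properties as ℚ
open import Data.Rational.Solver using (module +-*-Solver)
open import Data.Sum.Base using (_⊎_; inj₁; inj₂)
open import Data.Vec.Base using (Vec; lookup; tabulate)
open import Level using (0ℓ)
open import Relation.Binary.Structures using (IsEquivalence)
open import Relation.Binary.PropositionalEquality
  using (_≡_; _≢_; refl; sym; trans; cong; cong₂; subst)
open import Relation.Nullary using (¬_; yes; no; does)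
open import Relation.Unary using (Pred; Decidable; _∈_)

------------------------------------------------------------------------
-- Rational sequences

-- f m n → 0 as m , n → ∞
Small : (ℕ → ℕ → ℚ) → Set
Small f = ∀ ε → 0ℚ ℚ.< ε →
  ∃ λ N → ∀ m n → N ℕ.≤ m → N ℕ.≤ n → ∣ f m n ∣ ℚ.< ε

private
  ε/2>0 : ∀ {ε} → 0ℚ ℚ.< ε → 0ℚ ℚ.< ½ ℚ.* ε
  ε/2>0 {ε} ε>0 = subst (ℚ._< ½ ℚ.* ε) (ℚ.*-zeroʳ ½) (ℚ.*-monoʳ-<-pos ½ ε>0)

  halves : ∀ ε → ½ ℚ.* ε ℚ.+ ½ ℚ.* ε ≡ ε
  halves ε = trans (sym (ℚ.*-distribʳ-+ ε ½ ½)) (ℚ.*-identityˡ ε)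

  ⊔ˡ : ∀ {m n k} → m ⊔ n ℕ.≤ k → m ℕ.≤ k
  ⊔ˡ {m} {n} = ℕ.≤-trans (ℕ.m≤m⊔n m n)

  ⊔ʳ : ∀ {m n k} → m ⊔ n ℕ.≤ k → n ℕ.≤ k
  ⊔ʳ {m} {n} = ℕ.≤-trans (ℕ.m≤n⊔m m n)

  Bounded : (ℕ → ℕ → ℚ) → Set
  Bounded f = ∃ λ B → 0ℚ ℚ.< B ×
    ∃ λ N → ∀ m n → N ℕ.≤ m → N ℕ.≤ n → ∣ f m n ∣ ℚ.≤ B

  abstract
    small-cong : ∀ {f g} N → (∀ m n → N ℕ.≤ m → N ℕ.≤ n → f m n ≡ g m n) →
                 Small f → Small g
    small-cong N eq s ε ε>0 with s ε ε>0
    ... | K , p = N ⊔ K , λ m n le le′ →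
      subst (λ z → ∣ z ∣ ℚ.< ε) (eq m n (⊔ˡ le) (⊔ˡ le′)) (p m n (⊔ʳ le) (⊔ʳ le′))

    small-0 : Small (λ _ _ → 0ℚ)
    small-0 ε ε>0 = 0 , λ _ _ _ _ → ε>0

    small-+ : ∀ {f g} → Small f → Small g → Small (λ m n → f m n ℚ.+ g m n)
    small-+ {f} {g} s t ε ε>0 with s _ (ε/2>0 ε>0) | t _ (ε/2>0 ε>0)
    ... | N , p | K , q = N ⊔ K , λ m n le le′ →
      ℚ.≤-<-trans (ℚ.∣p+q∣≤∣p∣+∣q∣ (f m n) (g m n))
        (subst (∣ f m n ∣ ℚ.+ ∣ g m n ∣ ℚ.<_) (halves ε)
          (ℚ.+-mono-< (p m n (⊔ˡ le) (⊔ˡ le′)) (q m n (⊔ʳ le) (⊔ʳ le′))))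

    small-neg : ∀ {f} → Small f → Small (λ m n → ℚ.- f m n)
    small-neg {f} s ε ε>0 with s ε ε>0
    ... | N , p = N , λ m n le le′ →
      subst (ℚ._< ε) (sym (ℚ.∣-p∣≡∣p∣ (f m n))) (p m n le le′)

    small-* : ∀ {f g} → Small f → Bounded g → Small (λ m n → f m n ℚ.* g m n)
    small-* {f} {g} s (B , B>0 , K , q) ε ε>0 = N ⊔ K , λ m n le le′ →
      subst (ℚ._< ε) (sym (ℚ.∣p*q∣≡∣p∣*∣q∣ (f m n) (g m n)))
        (ℚ.≤-<-trans
          (ℚ.*-monoˡ-≤-nonNeg ∣ f m n ∣ ⦃ ℚ.∣-∣-nonNeg (f m n) ⦄ (q m n (⊔ʳ le) (⊔ʳ le′)))
          (subst (∣ f m n ∣ ℚ.* B ℚ.<_) cancel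
            (ℚ.*-monoˡ-<-pos B ⦃ B⁺ ⦄ (p m n (⊔ˡ le) (⊔ˡ le′)))))
      where
      B⁺ : ℚ.Positive B
      B⁺ = ℚ.positive B>0
      instance
        B≢0 : ℚ.NonZero B
        B≢0 = ℚ.pos⇒nonZero B ⦃ B⁺ ⦄
      1/B : ℚ
      1/B = ℚ.1/ B
      ε/B>0 : 0ℚ ℚ.< ε ℚ.* 1/B
      ε/B>0 = subst (ℚ._< ε ℚ.* 1/B) (ℚ.*-zeroˡ 1/B)
        (ℚ.*-monoˡ-<-pos 1/B ⦃ ℚ.1/pos⇒pos B ⦃ B⁺ ⦄ ⦄ ε>0)
      N : ℕ
      N = proj₁ (s (ε ℚ.* 1/B) ε/B>0)
      p : ∀ m n → N ℕ.≤ m → N ℕ.≤ n → ∣ f m n ∣ ℚ.< ε ℚ.* 1/B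
      p = proj₂ (s (ε ℚ.* 1/B) ε/B>0)
      cancel : ε ℚ.* 1/B ℚ.* B ≡ ε
      cancel = trans (ℚ.*-assoc ε 1/B B)
        (trans (cong (ε ℚ.*_) (ℚ.*-inverseˡ B)) (ℚ.*-identityʳ ε))

    bounded-* : ∀ {f g} → Bounded f → Bounded g → Bounded (λ m n → f m n ℚ.* g m n)
    bounded-* {f} {g} (A , A>0 , N , p) (B , B>0 , K , q) =
      A ℚ.* B , ℚ.positive⁻¹ (A ℚ.* B) ⦃ ℚ.pos*pos⇒pos A ⦃ A⁺ ⦄ B ⦃ B⁺ ⦄ ⦄ , N ⊔ K ,
      λ m n le le′ → subst (ℚ._≤ A ℚ.* B) (sym (ℚ.∣p*q∣≡∣p∣*∣q∣ (f m n) (g m n)))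
        (ℚ.≤-trans
          (ℚ.*-monoˡ-≤-nonNeg ∣ f m n ∣ ⦃ ℚ.∣-∣-nonNeg (f m n) ⦄ (q m n (⊔ʳ le) (⊔ʳ le′)))
          (ℚ.*-monoʳ-≤-nonNeg B ⦃ ℚ.pos⇒nonNeg B ⦃ B⁺ ⦄ ⦄ (p m n (⊔ˡ le) (⊔ˡ le′))))
      where
      A⁺ : ℚ.Positive A
      A⁺ = ℚ.positive A>0
      B⁺ : ℚ.Positive B
      B⁺ = ℚ.positive B>0

    swap- : ∀ p q → ∣ p ℚ.- q ∣ ≡ ∣ q ℚ.- p ∣
    swap- p q = trans
      (cong ∣_∣ (solve 2 (λ p q → p :- q := :- (q :- p)) refl p q)) (ℚ.∣-p∣≡∣p∣ (q ℚ.- p))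
      where open +-*-Solver

    p≤∣p∣ : ∀ p → p ℚ.≤ ∣ p ∣
    p≤∣p∣ p with ℚ.≤-total 0ℚ p
    ... | inj₁ 0≤p = ℚ.≤-reflexive (sym (ℚ.0≤p⇒∣p∣≡p 0≤p))
    ... | inj₂ p≤0 = ℚ.≤-trans p≤0 (ℚ.0≤∣p∣ p)

  -- 1/p, with the value 0 at p = 0
  inv : ℚ → ℚ
  inv p with p ℚ.≟ 0ℚ
  ... | yes _  = 0ℚ
  ... | no p≢0 = ℚ.1/_ p ⦃ ℚ.≢-nonZero p≢0 ⦄

  abstract
    *-inv : ∀ p → p ≢ 0ℚ → p ℚ.* inv p ≡ 1ℚ
    *-inv p p≢0 with p ℚ.≟ 0ℚ
    ... | yes p≡0 = ⊥-elim (p≢0 p≡0)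
    ... | no  p≢0 = ℚ.*-inverseʳ p ⦃ ℚ.≢-nonZero p≢0 ⦄

------------------------------------------------------------------------
-- Real numbers: Cauchy sequences of rationals, with the equality _≈_

record ℝ : Set where
  no-eta-equality
  field
    seq    : ℕ → ℚ
    cauchy : Small (λ m n → seq m ℚ.- seq n)

open ℝ

infix 4 _≈_ _<_ _≤_

record _≈_ (x y : ℝ) : Set where
  constructor mk≈
  field
    limit : ∀ ε → 0ℚ ℚ.< ε →
      ∃ λ N → ∀ n → N ℕ.≤ n → ∣ seq x n ℚ.- seq y n ∣ ℚ.< ε

open _≈_

_<_ : ℝ → ℝ → Set
x < y = ∃ λ δ → 0ℚ ℚ.< δ × ∃ λ N → ∀ n → N ℕ.≤ n → seq x n ℚ.+ δ ℚ.≤ seq y n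

_≤_ : ℝ → ℝ → Set
x ≤ y = ¬ (y < x)

private
  Diff : ℝ → ℝ → ℕ → ℕ → ℚ
  Diff x y n _ = seq x n ℚ.- seq y n

  ≈⇒small : ∀ {x y} → x ≈ y → Small (Diff x y)
  ≈⇒small p ε ε>0 with limit p ε ε>0
  ... | N , q = N , λ m _ le _ → q m le

  small⇒≈ : ∀ {x y} → Small (Diff x y) → x ≈ y
  small⇒≈ {x} {y} p = mk≈ λ ε ε>0 →
    proj₁ (p ε ε>0) , λ m le → proj₂ (p ε ε>0) m m le le

  pointwise : ∀ {x y} → (∀ n → seq x n ≡ seq y n) → x ≈ y
  pointwise {x} {y} eq = small⇒≈ {x} {y}
    (small-cong 0 (λ m _ _ _ → trans (sym (ℚ.+-inverseʳ (seq y m)))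
                                     (cong (ℚ._- seq y m) (sym (eq m)))) small-0)

  abstract
    0<1 : 0ℚ ℚ.< 1ℚ
    0<1 = ℚ.positive⁻¹ 1ℚ

    boundedˡ : ∀ x → Bounded (λ m _ → seq x m)
    boundedˡ x = B , B>0 , N , λ m _ le _ → bound m le
      where
      N : ℕ
      N = proj₁ (cauchy x 1ℚ 0<1)
      B : ℚ
      B = 1ℚ ℚ.+ ∣ seq x N ∣
      B>0 : 0ℚ ℚ.< B
      B>0 = subst (ℚ._< B) (ℚ.+-identityˡ 0ℚ) (ℚ.+-mono-<-≤ 0<1 (ℚ.0≤∣p∣ (seq x N)))
      cancel : ∀ a b → (a ℚ.- b) ℚ.+ b ≡ a
      cancel = solve 2 (λ a b → (a :- b) :+ b := a) refl
        where open +-*-Solver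
      bound : ∀ m → N ℕ.≤ m → ∣ seq x m ∣ ℚ.≤ B
      bound m le = subst (λ z → ∣ z ∣ ℚ.≤ B) (cancel (seq x m) (seq x N))
        (ℚ.≤-trans (ℚ.∣p+q∣≤∣p∣+∣q∣ (seq x m ℚ.- seq x N) (seq x N))
          (ℚ.+-monoˡ-≤ ∣ seq x N ∣
            (ℚ.<⇒≤ (proj₂ (cauchy x 1ℚ 0<1) m N le ℕ.≤-refl))))

    boundedʳ : ∀ x → Bounded (λ _ n → seq x n)
    boundedʳ x = B , B>0 , N , λ m n le le′ → p n m le′ le
      where
      B : ℚ
      B = proj₁ (boundedˡ x)
      B>0 : 0ℚ ℚ.< B
      B>0 = proj₁ (proj₂ (boundedˡ x))
      N : ℕ
      N = proj₁ (proj₂ (proj₂ (boundedˡ x)))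
      p : ∀ m n → N ℕ.≤ m → N ℕ.≤ n → ∣ seq x m ∣ ℚ.≤ B
      p = proj₂ (proj₂ (proj₂ (boundedˡ x)))

const : ℚ → ℝ
seq    (const p) _ = p
cauchy (const p) =
  small-cong {λ _ _ → 0ℚ} 0 (λ _ _ _ _ → sym (ℚ.+-inverseʳ p)) small-0

0ℝ 1ℝ : ℝ
0ℝ = const 0ℚ
1ℝ = const 1ℚ

infixl 6 _+_ _-_
infixl 7 _*_
infix  8 -_

_+_ : ℝ → ℝ → ℝ
seq    (x + y) n = seq x n ℚ.+ seq y n
cauchy (x + y) =
  small-cong 0
    (λ m n _ _ → solve 4 (λ a b c d → (a :- b) :+ (c :- d) := (a :+ c) :- (b :+ d))
      refl (seq x m) (seq x n) (seq y m) (seq y n))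
    (small-+ (cauchy x) (cauchy y))
  where open +-*-Solver

-_ : ℝ → ℝ
seq    (- x) n = ℚ.- seq x n
cauchy (- x) =
  small-cong 0
    (λ m n _ _ → solve 2 (λ a b → :- (a :- b) := :- a :- :- b) refl (seq x m) (seq x n))
    (small-neg (cauchy x))
  where open +-*-Solver

_-_ : ℝ → ℝ → ℝ
x - y = x + - y

_*_ : ℝ → ℝ → ℝ
seq    (x * y) n = seq x n ℚ.* seq y n
cauchy (x * y) =
  small-cong 0
    (λ m n _ _ → solve 4 (λ a b c d → (a :- b) :* c :+ (c :- d) :* b := a :* c :- b :* d)
      refl (seq x m) (seq x n) (seq y m) (seq y n))
    (small-+ (small-* (cauchy x) (boundedˡ y)) (small-* (cauchy y) (boundedʳ x)))
  where open +-*-Solver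

≈-isEquivalence : IsEquivalence _≈_
≈-isEquivalence = record
  { refl  = λ {x} → pointwise {x} {x} λ _ → refl
  ; sym   = λ {x} {y} p → mk≈ λ ε ε>0 → proj₁ (limit p ε ε>0) , λ n le →
      subst (ℚ._< ε) (swap- (seq x n) (seq y n)) (proj₂ (limit p ε ε>0) n le)
  ; trans = λ {x} {y} {z} p q → small⇒≈ {x} {z}
      (small-cong 0
        (λ m _ _ _ → solve 3 (λ a b c → (a :- b) :+ (b :- c) := a :- c)
          refl (seq x m) (seq y m) (seq z m))
        (small-+ (≈⇒small {x} {y} p) (≈⇒small {y} {z} q)))
  }
  where open +-*-Solver

+-cong : ∀ {x x′ y y′} → x ≈ x′ → y ≈ y′ → x + y ≈ x′ + y′
+-cong {x} {x′} {y} {y′} p q = small⇒≈ {x + y} {x′ + y′}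
  (small-cong 0
    (λ m _ _ _ → solve 4 (λ a b c d → (a :- b) :+ (c :- d) := (a :+ c) :- (b :+ d))
      refl (seq x m) (seq x′ m) (seq y m) (seq y′ m))
    (small-+ (≈⇒small {x} {x′} p) (≈⇒small {y} {y′} q)))
  where open +-*-Solver

-‿cong : ∀ {x y} → x ≈ y → - x ≈ - y
-‿cong {x} {y} p = small⇒≈ { - x } { - y }
  (small-cong 0
    (λ m _ _ _ → solve 2 (λ a b → :- (a :- b) := :- a :- :- b) refl (seq x m) (seq y m))
    (small-neg (≈⇒small {x} {y} p)))
  where open +-*-Solver

*-cong : ∀ {x x′ y y′} → x ≈ x′ → y ≈ y′ → x * y ≈ x′ * y′
*-cong {x} {x′} {y} {y′} p q = small⇒≈ {x * y} {x′ * y′}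
  (small-cong 0
    (λ m _ _ _ → solve 4 (λ a b c d → (a :- b) :* c :+ (c :- d) :* b := a :* c :- b :* d)
      refl (seq x m) (seq x′ m) (seq y m) (seq y′ m))
    (small-+ (small-* (≈⇒small {x} {x′} p) (boundedˡ y))
             (small-* (≈⇒small {y} {y′} q) (boundedˡ x′))))
  where open +-*-Solver

+-assoc : ∀ x y z → x + y + z ≈ x + (y + z)
+-assoc x y z = pointwise λ n → ℚ.+-assoc (seq x n) (seq y n) (seq z n)

+-comm : ∀ x y → x + y ≈ y + x
+-comm x y = pointwise λ n → ℚ.+-comm (seq x n) (seq y n)

+-identityˡ : ∀ x → 0ℝ + x ≈ x
+-identityˡ x = pointwise λ n → ℚ.+-identityˡ (seq x n)

+-identityʳ : ∀ x → x + 0ℝ ≈ x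
+-identityʳ x = pointwise λ n → ℚ.+-identityʳ (seq x n)

-‿inverseˡ : ∀ x → - x + x ≈ 0ℝ
-‿inverseˡ x = pointwise λ n → ℚ.+-inverseˡ (seq x n)

-‿inverseʳ : ∀ x → x + - x ≈ 0ℝ
-‿inverseʳ x = pointwise λ n → ℚ.+-inverseʳ (seq x n)

*-assoc : ∀ x y z → x * y * z ≈ x * (y * z)
*-assoc x y z = pointwise λ n → ℚ.*-assoc (seq x n) (seq y n) (seq z n)

*-comm : ∀ x y → x * y ≈ y * x
*-comm x y = pointwise λ n → ℚ.*-comm (seq x n) (seq y n)

*-identityˡ : ∀ x → 1ℝ * x ≈ x
*-identityˡ x = pointwise λ n → ℚ.*-identityˡ (seq x n)

*-identityʳ : ∀ x → x * 1ℝ ≈ x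
*-identityʳ x = pointwise λ n → ℚ.*-identityʳ (seq x n)

*-distribˡ-+ : ∀ x y z → x * (y + z) ≈ x * y + x * z
*-distribˡ-+ x y z = pointwise λ n → ℚ.*-distribˡ-+ (seq x n) (seq y n) (seq z n)

*-distribʳ-+ : ∀ x y z → (y + z) * x ≈ y * x + z * x
*-distribʳ-+ x y z = pointwise λ n → ℚ.*-distribʳ-+ (seq x n) (seq y n) (seq z n)

ℝ-commutativeRing : CommutativeRing 0ℓ 0ℓ
ℝ-commutativeRing = record
  { Carrier = ℝ ; _≈_ = _≈_ ; _+_ = _+_ ; _*_ = _*_ ; -_ = -_ ; 0# = 0ℝ ; 1# = 1ℝ
  ; isCommutativeRing = record
    { isRing = record
      { +-isAbelianGroup = record
        { isGroup = record
          { isMonoid = record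
            { isSemigroup = record
              { isMagma = record { isEquivalence = ≈-isEquivalence ; ∙-cong = +-cong }
              ; assoc = +-assoc }
            ; identity = +-identityˡ , +-identityʳ }
          ; inverse = -‿inverseˡ , -‿inverseʳ
          ; ⁻¹-cong = -‿cong }
        ; comm = +-comm }
      ; *-cong = *-cong
      ; *-assoc = *-assoc
      ; *-identity = *-identityˡ , *-identityʳ
      ; distrib = *-distribˡ-+ , *-distribʳ-+ }
    ; *-comm = *-comm } }

Apart₀ : ℝ → Set
Apart₀ x = ∃ λ δ → 0ℚ ℚ.< δ × ∃ λ N → ∀ n → N ℕ.≤ n → δ ℚ.≤ ∣ seq x n ∣

private
  abstract
    apart⇒≢0 : ∀ {δ p} → 0ℚ ℚ.< δ → δ ℚ.≤ ∣ p ∣ → p ≢ 0ℚ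
    apart⇒≢0 δ>0 δ≤ refl = ℚ.<-irrefl refl (ℚ.<-≤-trans δ>0 δ≤)

    ∣inv∣≤ : ∀ {δ p} (δ>0 : 0ℚ ℚ.< δ) → δ ℚ.≤ ∣ p ∣ → ∣ inv p ∣ ℚ.≤ inv δ
    ∣inv∣≤ {δ} {p} δ>0 δ≤ = ℚ.*-cancelˡ-≤-pos δ ⦃ ℚ.positive δ>0 ⦄
      (ℚ.≤-trans
        (ℚ.*-monoʳ-≤-nonNeg ∣ inv p ∣ ⦃ ℚ.∣-∣-nonNeg (inv p) ⦄ δ≤)
        (ℚ.≤-reflexive (trans (sym (ℚ.∣p*q∣≡∣p∣*∣q∣ p (inv p)))
          (trans (cong ∣_∣ (*-inv p (apart⇒≢0 δ>0 δ≤)))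
                 (sym (*-inv δ (λ eq → ℚ.<-irrefl (sym eq) δ>0)))))))

    inv>0 : ∀ {δ} → 0ℚ ℚ.< δ → 0ℚ ℚ.< inv δ
    inv>0 {δ} δ>0 = ℚ.*-cancelˡ-<-nonNeg δ ⦃ ℚ.pos⇒nonNeg δ ⦃ ℚ.positive δ>0 ⦄ ⦄
      (subst (ℚ._< δ ℚ.* inv δ) (sym (ℚ.*-zeroʳ δ))
        (subst (0ℚ ℚ.<_) (sym (*-inv δ (λ eq → ℚ.<-irrefl (sym eq) δ>0)))
          0<1))

    inv-diff : ∀ a b a′ b′ → a ℚ.* a′ ≡ 1ℚ → b ℚ.* b′ ≡ 1ℚ →
               ℚ.- (a ℚ.- b) ℚ.* (a′ ℚ.* b′) ≡ a′ ℚ.- b′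
    inv-diff a b a′ b′ aa′ bb′ = trans
      (solve 4 (λ a b a′ b′ → :- (a :- b) :* (a′ :* b′)
                           := (b :* b′) :* a′ :- (a :* a′) :* b′)
        refl a b a′ b′)
      (cong₂ ℚ._-_
        (trans (cong (ℚ._* a′) bb′) (ℚ.*-identityˡ a′))
        (trans (cong (ℚ._* b′) aa′) (ℚ.*-identityˡ b′)))
      where open +-*-Solver

recip : (x : ℝ) → Apart₀ x → ℝ
seq    (recip x (δ , δ>0 , N , p)) n = inv (seq x n)
cauchy (recip x (δ , δ>0 , N , p)) =
  small-cong N eq
    (small-* (small-neg (cauchy x))
      (bounded-* {λ m _ → inv (seq x m)} {λ _ n → inv (seq x n)}
        (inv δ , inv>0 δ>0 , N , λ m _ le _ → ∣inv∣≤ δ>0 (p m le))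
        (inv δ , inv>0 δ>0 , N , λ _ n _ le → ∣inv∣≤ δ>0 (p n le))))
  where
  eq : ∀ m n → N ℕ.≤ m → N ℕ.≤ n →
       ℚ.- (seq x m ℚ.- seq x n) ℚ.* (inv (seq x m) ℚ.* inv (seq x n))
         ≡ inv (seq x m) ℚ.- inv (seq x n)
  eq m n le le′ = inv-diff (seq x m) (seq x n) (inv (seq x m)) (inv (seq x n))
    (*-inv (seq x m) (apart⇒≢0 δ>0 (p m le)))
    (*-inv (seq x n) (apart⇒≢0 δ>0 (p n le′)))

*-recip : ∀ x (a : Apart₀ x) → x * recip x a ≈ 1ℝ
*-recip x a@(δ , δ>0 , N , p) = small⇒≈ {x * recip x a} {1ℝ}
  (small-cong N
    (λ m _ le _ → sym (cong (ℚ._- 1ℚ) (*-inv (seq x m) (apart⇒≢0 δ>0 (p m le)))))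
    small-0)

positive⇒apart : ∀ {x} → 0ℝ < x → Apart₀ x
positive⇒apart {x} (δ , δ>0 , N , p) = δ , δ>0 , N , λ n le →
  ℚ.≤-trans (subst (ℚ._≤ seq x n) (ℚ.+-identityˡ δ) (p n le)) (p≤∣p∣ (seq x n))

ℝ≥0 ℝ>0 : Set
ℝ≥0 = Σ ℝ (0ℝ ≤_)
ℝ>0 = Σ ℝ (0ℝ <_)

------------------------------------------------------------------------
-- Labeled fluid stochastic Petri nets

Arc : Set → Set → Set
Arc X Y = (X × Y) ⊎ (Y × X)

-- Finite sets are taken of the form Fin n.  The disjointness conditions
-- Pd ∩ Pc = P ∩ T = ∅ hold because the three sets are separate types, and
-- the initial continuous marking, which is always zero, is not stored.
record LFSPN (Act : Set) : Set where
  field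
    #Pd #Pc #T : ℕ

  Pd : Set
  Pd = Fin #Pd

  Pc : Set
  Pc = Fin #Pc

  Tr : Set
  Tr = Fin #T

  Marking : Set
  Marking = Vec ℕ #Pd

  field
    nonEmpty : #Pd ℕ.+ #Pc ℕ.+ #T ≢ 0
    W        : Arc Pd Tr → ℕ
    C        : Arc Pc Tr → Bool
    R        : Σ (Arc Pc Tr) (λ c → T (C c)) → Marking → ℝ≥0
    Ω        : Tr → Marking → ℝ>0
    L        : Tr → Act
    M₀       : Marking

module Dynamics {Act : Set} (N : LFSPN Act) where
  open LFSPN N

  Ena : Marking → Pred Tr 0ℓ
  Ena M t = ∀ p → W (inj₁ (p , t)) ℕ.≤ lookup M p

  Ena? : ∀ M → Decidable (Ena M)
  Ena? M t = all? λ p → W (inj₁ (p , t)) ℕ.≤? lookup M p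

  -- Meaningful when t ∈ Ena M, in which case the subtraction is exact.
  fire : Marking → Tr → Marking
  fire M t = tabulate λ p → (lookup M p ℕ.∸ W (inj₁ (p , t))) ℕ.+ W (inj₂ (t , p))

  _[_⟩_ : Marking → Tr → Marking → Set
  M [ t ⟩ M̃ = t ∈ Ena M × M̃ ≡ fire M t

  data DRS : Pred Marking 0ℓ where
    initial : M₀ ∈ DRS
    step    : ∀ {M t M̃} → M ∈ DRS → M [ t ⟩ M̃ → M̃ ∈ DRS

  Image : Marking → Act → Pred Marking 0ℓ
  Image M a M̃ = ∃ λ t → M [ t ⟩ M̃ × L t ≡ a

  -- The flow rate R(c , M), extended by 0 to pairs c that are not arcs.
  rate : Arc Pc Tr → Marking → ℝ
  rate c M with T? (C c)
  ... | yes c∈C = proj₁ (R (c , c∈C) M)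
  ... | no  _   = 0ℝ

  -- M₀ → M₁ → ⋯ → Mₙ for the sequence t₁ ⋯ tₙ starting in M₀ = M
  markings : Marking → List Tr → List Marking
  markings M []      = M ∷ []
  markings M (t ∷ ϑ) = M ∷ markings (fire M t) ϑ

  data Fireable : Marking → List Tr → Set where
    []  : ∀ {M} → Fireable M []
    _∷_ : ∀ {M t ϑ} → t ∈ Ena M → Fireable (fire M t) ϑ → Fireable M (t ∷ ϑ)

  TranSeq : Pred (List Tr) 0ℓ
  TranSeq = Fireable M₀

  words : ℕ → List (List Tr)
  words zero    = [] ∷ []
  words (suc n) = cartesianProductWith _∷_ (allFin #T) (words n)

  ∈-words : ∀ ϑ → ϑ ∈ₗ words (length ϑ)
  ∈-words []      = here refl
  ∈-words (t ∷ ϑ) = ∈ₗ.∈-cartesianProductWith⁺ _∷_ (∈ₗ.∈-allFin t) (∈-words ϑ)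

  words-unique : ∀ n → Unique (words n)
  words-unique zero    = [] ∷ []
  words-unique (suc n) =
    Unique.cartesianProductWith⁺ _∷_ Listₚ.∷-injective (Unique.allFin⁺ #T) (words-unique n)

Finite : {A : Set} → Pred A 0ℓ → Set
Finite S = ∃ λ xs → ∀ {x} → x ∈ S → x ∈ₗ xs

ImageFinite : {Act : Set} → LFSPN Act → Set
ImageFinite N = ∀ {M} → M ∈ DRS → ∀ a → Finite (Image M a)
  where open Dynamics N

data HMLflt (Act : Set) : Set where
  ⊤ᶠ   : HMLflt Act
  ⟨_⟩_ : Act → HMLflt Act → HMLflt Act

-- Equality of an element of ℝ ∪ {∞} (nothing is ∞) with a positive real.
_≈∞_ : Maybe ℝ → ℝ>0 → Set
just x  ≈∞ s = x ≈ proj₁ s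
nothing ≈∞ s = ⊥

------------------------------------------------------------------------
-- The inverse, restricted sums and the semantics distinguish cases by
-- conditions such as x ≈ y or L t ≡ a, which are only decidable classically.

module Classical (em : ExcludedMiddle 0ℓ) where

  ≉0⇒apart : ∀ x → ¬ (x ≈ 0ℝ) → Apart₀ x
  ≉0⇒apart x x≉0 with em {Apart₀ x}
  ... | yes a = a
  ... | no ¬a = ⊥-elim (x≉0 (mk≈ x→0))
    where
    open +-*-Solver
    x→0 : ∀ ε → 0ℚ ℚ.< ε →
      ∃ λ N → ∀ n → N ℕ.≤ n → ∣ seq x n ℚ.- 0ℚ ∣ ℚ.< ε
    x→0 ε ε>0 with cauchy x (½ ℚ.* ε) (ε/2>0 ε>0)
    ... | N , p with em {∃ λ n → N ℕ.≤ n × ∣ seq x n ∣ ℚ.< ½ ℚ.* ε}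
    ...   | no ¬q = ⊥-elim (¬a (½ ℚ.* ε , ε/2>0 ε>0 , N ,
                      λ n le → ℚ.≮⇒≥ λ lt → ¬q (n , le , lt)))
    ...   | yes (n , le , lt) = N , λ m le′ →
      subst (λ z → ∣ z ∣ ℚ.< ε)
        (solve 2 (λ a b → (a :- b) :+ b := a :- con 0ℚ) refl (seq x m) (seq x n))
        (ℚ.≤-<-trans (ℚ.∣p+q∣≤∣p∣+∣q∣ (seq x m ℚ.- seq x n) (seq x n))
          (subst (∣ seq x m ℚ.- seq x n ∣ ℚ.+ ∣ seq x n ∣ ℚ.<_) (halves ε)
            (ℚ.+-mono-< (p m n le′ le) lt)))

  infix 8 _⁻¹

  -- 0⁻¹ = 0; only inverses of positive numbers matter below.
  _⁻¹ : ℝ → ℝ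
  x ⁻¹ with em {x ≈ 0ℝ}
  ... | yes _  = 0ℝ
  ... | no x≉0 = recip x (≉0⇒apart x x≉0)

  *-inverseʳ : ∀ x → ¬ (x ≈ 0ℝ) → x * x ⁻¹ ≈ 1ℝ
  *-inverseʳ x x≉0 with em {x ≈ 0ℝ}
  ... | yes x≈0 = ⊥-elim (x≉0 x≈0)
  ... | no x≉0′ = *-recip x (≉0⇒apart x x≉0′)

  ∑ : {A : Set} → List A → (A → Set) → (A → ℝ) → ℝ
  ∑ xs P f = foldr _+_ 0ℝ (map f (filter (λ x → em {P x}) xs))

  module Semantics {Act : Set} (N : LFSPN Act) (q : LFSPN.Pc N) where
    open LFSPN N
    open Dynamics N

    ∑ᵀ : (Tr → Set) → (Tr → ℝ) → ℝ
    ∑ᵀ = ∑ (allFin #T)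

    exitRate : Marking → ℝ
    exitRate M = ∑ᵀ (Ena M) (λ t → proj₁ (Ω t M))

    SJ : Marking → Maybe ℝ
    SJ M = if does (any? (Ena? M)) then just (exitRate M ⁻¹) else nothing

    PT : Tr → Marking → ℝ
    PT t M = proj₁ (Ω t M) * exitRate M ⁻¹

    RP : Marking → ℝ
    RP M = ∑ᵀ (λ t → t ∈ Ena M × T (C (inj₂ (t , q)))) (λ t → rate (inj₂ (t , q)) M)
         - ∑ᵀ (λ t → t ∈ Ena M × T (C (inj₁ (q , t)))) (λ t → rate (inj₁ (q , t)) M)

    PT* : Marking → List Tr → ℝ
    PT* M []      = 1ℝ
    PT* M (t ∷ ϑ) = PT t M * PT* (fire M t) ϑ

    TranSeqOf : List Act → List ℝ>0 → List ℝ → Pred (List Tr) 0ℓ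
    TranSeqOf σ ς ϱ ϑ = ϑ ∈ TranSeq
                      × map L ϑ ≡ σ
                      × Pointwise _≈∞_ (map SJ (markings M₀ ϑ)) ς
                      × Pointwise _≈_  (map RP (markings M₀ ϑ)) ϱ

    TranSeqOf⊆words : ∀ {σ ς ϱ ϑ} → ϑ ∈ TranSeqOf σ ς ϱ → ϑ ∈ₗ words (length σ)
    TranSeqOf⊆words {ϑ = ϑ} (_ , refl , _) =
      subst (λ n → ϑ ∈ₗ words n) (sym (Listₚ.length-map L ϑ)) (∈-words ϑ)

    -- By TranSeqOf⊆words and words-unique, the sum over TranSeqOf σ ς ϱ.
    traceProb : List Act → List ℝ>0 → List ℝ → ℝ
    traceProb σ ς ϱ = ∑ (words (length σ)) (TranSeqOf σ ς ϱ) (PT* M₀)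

    ⟦_⟧ : HMLflt Act → Marking → List ℝ>0 → List ℝ → ℝ
    ⟦ ⊤ᶠ ⟧ M ς ϱ =
      if does (em {Pointwise _≈∞_ (SJ M ∷ []) ς × Pointwise _≈_ (RP M ∷ []) ϱ})
      then 1ℝ else 0ℝ
    ⟦ ⟨ a ⟩ Φ ⟧ M []      _       = 0ℝ
    ⟦ ⟨ a ⟩ Φ ⟧ M (_ ∷ _) []      = 0ℝ
    ⟦ ⟨ a ⟩ Φ ⟧ M (s ∷ ς) (r ∷ ϱ) =
      if does (em {SJ M ≈∞ s × RP M ≈ r})
      then ∑ᵀ (λ t → t ∈ Ena M × L t ≡ a) (λ t → PT t M * ⟦ Φ ⟧ (fire M t) ς ϱ)
      else 0ℝ

  FluidTraceEquivalent : {Act : Set} (N : LFSPN Act) → LFSPN.Pc N →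
                         (N′ : LFSPN Act) → LFSPN.Pc N′ → Set
  FluidTraceEquivalent N q N′ q′ = ∀ σ ς ϱ → S.traceProb σ ς ϱ ≈ S′.traceProb σ ς ϱ
    where
    module S  = Semantics N q
    module S′ = Semantics N′ q′

  HMLfltEquivalent : {Act : Set} (N : LFSPN Act) → LFSPN.Pc N →
                     (N′ : LFSPN Act) → LFSPN.Pc N′ → Set
  HMLfltEquivalent N q N′ q′ = ∀ Φ ς ϱ →
    S.⟦ Φ ⟧ (LFSPN.M₀ N) ς ϱ ≈ S′.⟦ Φ ⟧ (LFSPN.M₀ N′) ς ϱ
    where
    module S  = Semantics N q
    module S′ = Semantics N′ q′

{-# OPTIONS --safe #-}
-- A formula is a sequence of actions σ = a₁ ⋯ aₙ.  By induction on σ, its value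
-- at any marking M is the total probability of the transition sequences from M
-- that match σ, ς and ϱ: a matching sequence t ∷ ϑ has t enabled in M and
-- labeled a₁, and PT* factors as PT t M times the probability of ϑ.
module Submission where

open import Defs
open import Algebra.Bundles using (CommutativeRing)
open import Axiom.ExcludedMiddle using (ExcludedMiddle)
open import Data.Empty using (⊥-elim)
open import Data.List.Base using (List; []; _∷_; _++_; map; foldr; length; allFin; cartesianProductWith)
open import Data.List.Properties using (filter-accept; filter-reject)
open import Data.List.Relation.Binary.Pointwise using (Pointwise; []; _∷_)
open import Data.Product.Base using (_×_; _,_)
open import Function.Base using (_∘_)
open import Function.Bundles using (_⇔_; mk⇔; Equivalence)
open import Level using (0ℓ)
open import Relation.Binary.PropositionalEquality using (_≡_; refl; cong; subst)
open import Relation.Nullary using (¬_; yes; no)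
open import Relation.Unary using (Pred)

open CommutativeRing ℝ-commutativeRing
  using (setoid; zeroʳ; +-congˡ; *-congˡ)
  renaming (refl to ≈-refl; sym to ≈-sym; trans to ≈-trans; reflexive to ≈-reflexive)
open import Relation.Binary.Reasoning.Setoid setoid

module RestrictedSums (em : ExcludedMiddle 0ℓ) where
  open Classical em

  module _ {A : Set} {P : A → Set} {f : A → ℝ} where

    ∑-accept : ∀ {x} xs → P x → ∑ (x ∷ xs) P f ≈ f x + ∑ xs P f
    ∑-accept xs px =
      ≈-reflexive (cong (foldr _+_ 0ℝ ∘ map f) (filter-accept (λ x → em {P x}) px))

    ∑-reject : ∀ {x} xs → ¬ P x → ∑ (x ∷ xs) P f ≈ ∑ xs P f
    ∑-reject xs ¬px =
      ≈-reflexive (cong (foldr _+_ 0ℝ ∘ map f) (filter-reject (λ x → em {P x}) ¬px))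

    ∑-empty : ∀ xs → (∀ x → ¬ P x) → ∑ xs P f ≈ 0ℝ
    ∑-empty []       ¬p = ≈-refl
    ∑-empty (x ∷ xs) ¬p = ≈-trans (∑-reject xs (¬p x)) (∑-empty xs ¬p)

    ∑-++ : ∀ xs ys → ∑ (xs ++ ys) P f ≈ ∑ xs P f + ∑ ys P f
    ∑-++ []       ys = ≈-sym (+-identityˡ _)
    ∑-++ (x ∷ xs) ys with em {P x}
    ... | yes _ = ≈-trans (+-congˡ (∑-++ xs ys)) (≈-sym (+-assoc _ _ _))
    ... | no  _ = ∑-++ xs ys

    ∑-*ˡ : ∀ c xs → ∑ xs P (λ x → c * f x) ≈ c * ∑ xs P f
    ∑-*ˡ c []       = ≈-sym (zeroʳ c)
    ∑-*ˡ c (x ∷ xs) with em {P x}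
    ... | yes _ = ≈-trans (+-congˡ (∑-*ˡ c xs)) (≈-sym (*-distribˡ-+ c _ _))
    ... | no  _ = ∑-*ˡ c xs

    ∑-congˡ : ∀ {Q} xs → (∀ x → P x ⇔ Q x) → ∑ xs P f ≈ ∑ xs Q f
    ∑-congˡ         []       P⇔Q = ≈-refl
    ∑-congˡ {Q = Q} (x ∷ xs) P⇔Q with em {P x} | em {Q x}
    ... | yes _  | yes _  = +-congˡ (∑-congˡ xs P⇔Q)
    ... | no  _  | no  _  = ∑-congˡ xs P⇔Q
    ... | yes px | no ¬qx = ⊥-elim (¬qx (Equivalence.to (P⇔Q x) px))
    ... | no ¬px | yes qx = ⊥-elim (¬px (Equivalence.from (P⇔Q x) qx))

    -- Agreement of `f` and `g` is asked for only on `P`: the summands rewritten below agree by an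
    -- argument that uses that `t` is enabled and labeled `a`.
    ∑-congʳ : ∀ {g} xs → (∀ x → P x → f x ≈ g x) → ∑ xs P f ≈ ∑ xs P g
    ∑-congʳ []       f≈g = ≈-refl
    ∑-congʳ (x ∷ xs) f≈g with em {P x}
    ... | yes px = +-cong (f≈g x px) (∑-congʳ xs f≈g)
    ... | no  _  = ∑-congʳ xs f≈g

  ∑-map : ∀ {A B : Set} {P : B → Set} {f : B → ℝ} (g : A → B) xs →
          ∑ (map g xs) P f ≈ ∑ xs (P ∘ g) (f ∘ g)
  ∑-map         g []       = ≈-refl
  ∑-map {P = P} g (x ∷ xs) with em {P (g x)}
  ... | yes _ = +-congˡ (∑-map g xs)
  ... | no  _ = ∑-map g xs

  -- A double sum with a filter on the outer index: since `P (g x y)` forces `Q x`, discarding the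
  -- `x` outside `Q` loses nothing. With `g = _∷_` it splits a sum over words by their first letter.
  ∑-cartesianProductWith :
    ∀ {A B D : Set} {P : D → Set} {Q : A → Set} {f : D → ℝ} (g : A → B → D) xs ys →
    (∀ x y → P (g x y) → Q x) →
    ∑ (cartesianProductWith g xs ys) P f ≈
    ∑ xs Q (λ x → ∑ ys (P ∘ g x) (f ∘ g x))
  ∑-cartesianProductWith g []       ys P⇒Q = ≈-refl
  ∑-cartesianProductWith {P = P} {Q} {f} g (x ∷ xs) ys P⇒Q = begin
    ∑ (map (g x) ys ++ cartesianProductWith g xs ys) P f
      ≈⟨ ∑-++ (map (g x) ys) _ ⟩
    ∑ (map (g x) ys) P f + ∑ (cartesianProductWith g xs ys) P f
      ≈⟨ +-cong (∑-map (g x) ys) (∑-cartesianProductWith g xs ys P⇒Q) ⟩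
    row x + ∑ xs Q row
      ≈⟨ absorb ⟩
    ∑ (x ∷ xs) Q row ∎
    where
    row = λ x → ∑ ys (P ∘ g x) (f ∘ g x)
    absorb : row x + ∑ xs Q row ≈ ∑ (x ∷ xs) Q row
    absorb with em {Q x}
    ... | yes _  = ≈-refl
    -- No `y` satisfies `P (g x y)` here, so the row of `x` is `0ℝ`.
    ... | no ¬qx = ≈-trans (+-cong (∑-empty ys (λ y → ¬qx ∘ P⇒Q x y)) ≈-refl) (+-identityˡ _)

diamonds : ∀ {Act : Set} → List Act → HMLflt Act
diamonds []      = ⊤ᶠ
diamonds (a ∷ σ) = ⟨ a ⟩ diamonds σ

actions : ∀ {Act : Set} → HMLflt Act → List Act
actions ⊤ᶠ        = []
actions (⟨ a ⟩ Φ) = a ∷ actions Φ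

-- Reduces logical equivalence, quantified over formulas, to a statement quantified over action
-- sequences.
diamonds-actions : ∀ {Act : Set} (Φ : HMLflt Act) → diamonds (actions Φ) ≡ Φ
diamonds-actions ⊤ᶠ        = refl
diamonds-actions (⟨ a ⟩ Φ) = cong (⟨ a ⟩_) (diamonds-actions Φ)

module TraceSemantics (em : ExcludedMiddle 0ℓ) {Act : Set} (N : LFSPN Act) (q : LFSPN.Pc N) where
  open LFSPN N
  open Dynamics N
  open Classical em
  open Semantics N q
  open RestrictedSums em

  -- `TranSeqOf` with the starting marking as a parameter, because the induction passes from `M` to
  -- `fire M t`; at `M₀` both unfold to the same condition.
  TranSeqFrom : Marking → List Act → List ℝ>0 → List ℝ → Pred (List Tr) 0ℓ
  TranSeqFrom M σ ς ϱ ϑ = Fireable M ϑ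
                        × map L ϑ ≡ σ
                        × Pointwise _≈∞_ (map SJ (markings M ϑ)) ς
                        × Pointwise _≈_  (map RP (markings M ϑ)) ϱ

  traceProbFrom : Marking → List Act → List ℝ>0 → List ℝ → ℝ
  traceProbFrom M σ ς ϱ = ∑ (words (length σ)) (TranSeqFrom M σ ς ϱ) (PT* M)

  -- Each of the four conditions on `t ∷ ϑ` splits into one on its first entry and one on `ϑ` from
  -- `fire M t`; the hypotheses are exactly the conditions on the first entries.
  TranSeqFrom-∷ : ∀ {M a σ s ς r ϱ t} → SJ M ≈∞ s → RP M ≈ r → Ena M t × L t ≡ a →
                  ∀ ϑ → TranSeqFrom M (a ∷ σ) (s ∷ ς) (r ∷ ϱ) (t ∷ ϑ) ⇔
                        TranSeqFrom (fire M t) σ ς ϱ ϑ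
  TranSeqFrom-∷ sj rp (en , refl) ϑ = mk⇔
    (λ { (_ ∷ fs , refl , _ ∷ sjs , _ ∷ rps) → fs , refl , sjs , rps })
    (λ { (fs , refl , sjs , rps) → en ∷ fs , refl , sj ∷ sjs , rp ∷ rps })

  ⟦diamonds⟧≈traceProbFrom : ∀ M σ ς ϱ → ⟦ diamonds σ ⟧ M ς ϱ ≈ traceProbFrom M σ ς ϱ
  ⟦diamonds⟧≈traceProbFrom M [] ς ϱ
    with em {Pointwise _≈∞_ (SJ M ∷ []) ς × Pointwise _≈_ (RP M ∷ []) ϱ}
  -- `words 0` holds only the empty sequence, whose `PT*` is `1ℝ`.
  ... | yes (sj , rp) = ≈-sym (≈-trans (∑-accept [] ([] , refl , sj , rp)) (+-identityʳ 1ℝ))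
  ... | no ¬m = ≈-sym (∑-reject [] λ { (_ , _ , m) → ¬m m })
  -- `markings` is never empty, so nothing matches an empty `ς` or `ϱ`; the empty transition
  -- sequence already fails on the labels.
  ⟦diamonds⟧≈traceProbFrom M (a ∷ σ) [] ϱ =
    ≈-sym (∑-empty (words (length (a ∷ σ))) λ { [] (_ , () , _) ; (_ ∷ _) (_ , _ , () , _) })
  ⟦diamonds⟧≈traceProbFrom M (a ∷ σ) (s ∷ ς) [] =
    ≈-sym (∑-empty (words (length (a ∷ σ))) λ { [] (_ , () , _) ; (_ ∷ _) (_ , _ , _ , ()) })
  ⟦diamonds⟧≈traceProbFrom M (a ∷ σ) (s ∷ ς) (r ∷ ϱ) with em {SJ M ≈∞ s × RP M ≈ r}
  -- Every sequence from `M` has `SJ M` and `RP M` as first entries, so a mismatch there excludes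
  -- them all.
  ... | no ¬m = ≈-sym (∑-empty (words (length (a ∷ σ)))
    λ { [] (_ , () , _) ; (_ ∷ _) (_ , _ , sj ∷ _ , rp ∷ _) → ¬m (sj , rp) })
  ... | yes (sj , rp) = begin
    ∑ᵀ Q (λ t → PT t M * ⟦ diamonds σ ⟧ (fire M t) ς ϱ)
      ≈⟨ ∑-congʳ (allFin #T) (λ t qt → ≈-trans
           (*-congˡ (⟦diamonds⟧≈traceProbFrom (fire M t) σ ς ϱ))
           (≈-sym (≈-trans
             -- `PT* M (t ∷ ϑ)` is by definition `PT t M * PT* (fire M t) ϑ`, so once the condition
             -- is rewritten, `PT t M` comes out of the sum.
             (∑-congˡ (words (length σ)) (TranSeqFrom-∷ sj rp qt))
             (∑-*ˡ (PT t M) (words (length σ)))))) ⟩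
    ∑ᵀ Q (λ t → ∑ (words (length σ)) (λ ϑ → P (t ∷ ϑ)) (λ ϑ → PT* M (t ∷ ϑ)))
      ≈⟨ ≈-sym (∑-cartesianProductWith _∷_ (allFin #T) (words (length σ))
           -- A match of `t ∷ ϑ` forces `Q t`, the filter of the outer sum.
           λ { t ϑ (en ∷ _ , refl , _) → en , refl }) ⟩
    traceProbFrom M (a ∷ σ) (s ∷ ς) (r ∷ ϱ) ∎
    where
    Q = λ t → Ena M t × L t ≡ a
    P = TranSeqFrom M (a ∷ σ) (s ∷ ς) (r ∷ ϱ)

  ⟦diamonds⟧≈traceProb : ∀ σ ς ϱ → ⟦ diamonds σ ⟧ M₀ ς ϱ ≈ traceProb σ ς ϱ
  ⟦diamonds⟧≈traceProb = ⟦diamonds⟧≈traceProbFrom M₀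

theorem8p1 : (em : ExcludedMiddle 0ℓ) {Act : Set} (N N′ : LFSPN Act)
    (q : LFSPN.Pc N) (q′ : LFSPN.Pc N′) →
    (∀ p → p ≡ q) → (∀ p → p ≡ q′) →
    ImageFinite N → ImageFinite N′ →
    Classical.FluidTraceEquivalent em N q N′ q′ ⇔ Classical.HMLfltEquivalent em N q N′ q′
theorem8p1 em N N′ q q′ _ _ _ _ = mk⇔
  (λ N≡N′ Φ ς ϱ →
    subst (λ Φ → S.⟦ Φ ⟧ (LFSPN.M₀ N) ς ϱ ≈ S′.⟦ Φ ⟧ (LFSPN.M₀ N′) ς ϱ) (diamonds-actions Φ)
      (≈-trans (T.⟦diamonds⟧≈traceProb (actions Φ) ς ϱ)
        (≈-trans (N≡N′ (actions Φ) ς ϱ)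
          (≈-sym (T′.⟦diamonds⟧≈traceProb (actions Φ) ς ϱ)))))
  (λ N=N′ σ ς ϱ →
    ≈-trans (≈-sym (T.⟦diamonds⟧≈traceProb σ ς ϱ))
      (≈-trans (N=N′ (diamonds σ) ς ϱ) (T′.⟦diamonds⟧≈traceProb σ ς ϱ)))
  where
  module S  = Classical.Semantics em N q
  module S′ = Classical.Semantics em N′ q′
  module T  = TraceSemantics em N q
  module T′ = TraceSemantics em N′ q′
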